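{- Let $n>l\ge k>0$ and let $\mathcal{F}$ be a perfectly-$k$ balanced hash family from $[n]$ to $[l]$. Then: (a) if $k$ is odd, $$|\mathcal{F}|\ge\frac{\sum_{i=0}^{\lfloor k/2\rfloor}\binom{n}{i}}{\sum_{i=0}^{\lfloor k/2\rfloor}\binom{l}{i}};$$ (b) if $k$ is even, $$|\mathcal{F}|\ge\frac{\left(\sum_{i=0}^{k/2}\binom{n}{i}\right)-\binom{n-1}{k/2}}{\sum_{i=0}^{k/2}\binom{l}{i}}.$$
   Context: $[m]=\{1,\ldots,m\}$. For $n>l\ge k>0$, a family $\mathcal{F}$ of functions $\pi:[n]\to[l]$ is a perfectly-$k$ balanced hash family if for some integer $c\ge1$ and all $S\subseteq[n]$ with $|S|=k$, the number of functions in $\mathcal{F}$ that are injective on $S$ equals $c$. -}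

module Defs where

open import Data.Fin using (Fin; _≟_)
open import Data.Fin.Properties using (all?)
open import Data.Fin.Subset using (Subset; _∈_; ∣_∣)
open import Data.Fin.Subset.Properties using (_∈?_)
open import Data.List using (List; length; filter; sum; applyUpTo)
open import Data.Nat using (ℕ; suc; _≥_)
open import Data.Nat.Combinatorics using (_C_)
open import Data.Product using (∃-syntax; _×_)
open import Relation.Binary.PropositionalEquality using (_≡_)
open import Relation.Nullary using (Dec)
open import Relation.Nullary.Decidable using (_→-dec_)

InjectiveOn : ∀ {n l} → Subset n → (Fin n → Fin l) → Set
InjectiveOn S π = ∀ x y → x ∈ S → y ∈ S → π x ≡ π y → x ≡ y

injectiveOn? : ∀ {n l} (S : Subset n) (π : Fin n → Fin l) → Dec (InjectiveOn S π)
injectiveOn? S π = all? λ x → all? λ y →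
  (x ∈? S) →-dec ((y ∈? S) →-dec ((π x ≟ π y) →-dec (x ≟ y)))

-- A family is a finite list of functions, so repeated members are allowed and
-- are counted with multiplicity, both here and in the size of the family.
-- Families without repetitions are a special case.
Family : ℕ → ℕ → Set
Family n l = List (Fin n → Fin l)

#injectiveOn : ∀ {n l} → Family n l → Subset n → ℕ
#injectiveOn F S = length (filter (injectiveOn? S) F)

PerfectlyBalanced : ∀ {n l} → ℕ → Family n l → Set
PerfectlyBalanced {n} k F =
  ∃[ c ] (c ≥ 1 × ((S : Subset n) → ∣ S ∣ ≡ k → #injectiveOn F S ≡ c))

-- The terms are those with index 0, …, m, both ends included.
binomialSum : ℕ → ℕ → ℕ
binomialSum n m = sum (applyUpTo (n C_) (suc m))

{-# OPTIONS --safe #-}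
-- Let d = ⌊k/2⌋ and e = k − d ≥ d.  If (n C d) > ∣F∣ (l C d), linear algebra gives
-- a nonzero weight x on the d-subsets of [n] such that, for every π in F and every
-- d-subset Y of [l], the weights of the sets A that π maps bijectively onto Y sum
-- to 0.  For ∣q∣ = e, a set A disjoint from q is counted by exactly c functions,
-- those that are injective on A and on q with disjoint images; hence the weights of
-- the A disjoint from q sum to 0.  Averaging extends this to ∣q∣ ≤ e, and
-- inclusion–exclusion then gives x = 0.  So ∣F∣ ≥ (n C d) / (l C d), which is at
-- least Σ (n C i) / Σ (l C i) since (n C i) / (l C i) increases with i ≤ d.  The
-- bound for odd k therefore holds for all k, and it implies the one for even k.
module Submission where

open import Defs
open import Data.Bool using (if_then_else_; true; false)
import Data.Bool.Properties as Bool
open import Data.Fin using (Fin; zero; suc; punchIn; punchOut; combine; remQuot)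
import Data.Fin as Fin
open import Data.Fin.Properties using (any?; all?; punchIn-punchOut; punchInᵢ≢i; remQuot-combine)
import Data.Fin.Properties as Fin
open import Data.Fin.Subset using (Subset; inside; outside; _∈_; _∉_; _⊆_; _∪_; ⁅_⁆; ⊥; ∁; ∣_∣)
open import Data.Fin.Subset.Properties
open import Data.Integer using (ℤ; +_; _-_; -_; _+_; _*_; 0ℤ; 1ℤ)
import Data.Integer as ℤ
import Data.Integer.Properties as ℤ
open import Data.Integer.Tactic.RingSolver using (solve-∀)
open import Algebra.Properties.CommutativeSemigroup ℤ.*-commutativeSemigroup using (x∙yz≈y∙xz)
open import Algebra.Properties.Semiring.Sum ℤ.+-*-semiring
open import Data.List using (List; []; _∷_; _++_; _∷ʳ_; applyUpTo; length; map; lookup; filter)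
open import Data.List.Properties using (length-map; length-++; applyUpTo-∷ʳ)
open import Data.List.Membership.Propositional using () renaming (_∈_ to _∈ˡ_)
open import Data.List.Membership.Propositional.Properties using (∈-map⁺; ∈-map⁻; ∈-++⁺ˡ; ∈-++⁺ʳ; ∈-lookup)
open import Data.List.Relation.Unary.All using (All; []; _∷_)
import Data.List.Relation.Unary.All as All
import Data.List.Relation.Unary.All.Properties as All
open import Data.List.Relation.Unary.AllPairs using ([]; _∷_)
open import Data.List.Relation.Unary.Any using (here; there)
import Data.List.Relation.Unary.Any as Any
import Data.List.Relation.Unary.Any.Properties as Any
open import Data.List.Relation.Unary.Unique.Propositional using (Unique)
import Data.List.Relation.Unary.Unique.Propositional.Properties as Unique
open import Data.Nat using (ℕ; zero; suc; _>_; _∸_; ⌊_/2⌋; ⌈_/2⌉; NonZero) renaming (_≥_ to _≥ℕ_)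
import Data.Nat as ℕ
import Data.Nat.ListAction as List
open import Data.Nat.ListAction.Properties using (sum-++)
import Data.Nat.Properties as ℕ
import Data.Nat.Tactic.RingSolver as ℕ
open import Data.Nat.Combinatorics using (_C_; nCk+nC[k+1]≡[n+1]C[k+1]; nC1≡n)
open import Data.Nat.Divisibility using (_∣_)
open import Data.Product using (_×_; _,_; ∃-syntax; Σ-syntax; proj₁)
open import Data.Rational using (_/_; _≥_; toℚᵘ)
import Data.Rational.Properties as ℚ
import Data.Rational.Unnormalised as ℚᵘ
import Data.Rational.Unnormalised.Properties as ℚᵘ
open import Data.Sum using (_⊎_; inj₁; inj₂; [_,_]′)
open import Data.Vec using ([]; _∷_; here; there)
open import Data.Vec.Properties using (∷-injectiveʳ; ≡-dec)
open import Function using (_∘_; id)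
open import Relation.Binary.PropositionalEquality
open import Relation.Nullary using (¬_; Dec; yes; no; does; contradiction)
open import Relation.Nullary.Decidable using (¬?; _×-dec_; _→-dec_; decidable-stable; dec-true; dec-false)

-- Finite sums of integers.

sum-zero : ∀ {n} (f : Fin n → ℤ) → (∀ i → f i ≡ 0ℤ) → sum f ≡ 0ℤ
sum-zero {n} f f≡0 = trans (sum-cong-≗ f≡0) (sum-replicate-zero n)

sum-single : ∀ {n} (f : Fin n → ℤ) i → (∀ j → j ≢ i → f j ≡ 0ℤ) → sum f ≡ f i
sum-single {suc n} f i f≡0 = begin
  sum f                            ≡⟨ sum-remove {i = i} f ⟩
  f i + sum (f ∘ punchIn i)        ≡⟨ cong (λ z → f i + z) (sum-zero _ λ j → f≡0 _ (punchInᵢ≢i i j)) ⟩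
  f i + 0ℤ                         ≡⟨ ℤ.+-identityʳ _ ⟩
  f i                              ∎
  where open ≡-Reasoning

sum-linear : ∀ {n} c d (f g : Fin n → ℤ) →
  sum (λ i → c * f i - d * g i) ≡ c * sum f - d * sum g
sum-linear c d f g = begin
  sum (λ i → c * f i - d * g i)                 ≡⟨ ∑-distrib-+ (λ i → c * f i) (λ i → - (d * g i)) ⟩
  sum (λ i → c * f i) + sum (λ i → - (d * g i)) ≡⟨ cong₂ _+_ (sym (*-distribˡ-sum c f))
                                                     (sum-cong-≗ λ i → ℤ.neg-distribˡ-* d (g i)) ⟩
  c * sum f + sum (λ i → (- d) * g i)           ≡⟨ cong (λ z → c * sum f + z) (*-distribˡ-sum (- d) g) ⟨
  c * sum f + (- d) * sum g                     ≡⟨ cong (λ z → c * sum f + z) (ℤ.neg-distribˡ-* d _) ⟨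
  c * sum f - d * sum g                         ∎
  where open ≡-Reasoning

-- The common form of the double counts below: a vector `x` is paired with a combination of the rows
-- of `t`, and the coefficients `u` are pulled out.
sum-exchange : ∀ {m n} (x : Fin n → ℤ) (u : Fin m → ℤ) (t : Fin m → Fin n → ℤ) →
  sum (λ i → x i * sum (λ j → u j * t j i)) ≡ sum (λ j → u j * sum (λ i → x i * t j i))
sum-exchange x u t = begin
  sum (λ i → x i * sum (λ j → u j * t j i))
    ≡⟨ sum-cong-≗ (λ i → *-distribˡ-sum (x i) (λ j → u j * t j i)) ⟩
  sum (λ i → sum (λ j → x i * (u j * t j i)))
    ≡⟨ ∑-comm (λ i j → x i * (u j * t j i)) ⟩
  sum (λ j → sum (λ i → x i * (u j * t j i)))
    ≡⟨ sum-cong-≗ (λ j → sum-cong-≗ λ i → x∙yz≈y∙xz (x i) (u j) (t j i)) ⟩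
  sum (λ j → sum (λ i → u j * (x i * t j i)))
    ≡⟨ sum-cong-≗ (λ j → *-distribˡ-sum (u j) (λ i → x i * t j i)) ⟨
  sum (λ j → u j * sum (λ i → x i * t j i)) ∎
  where
  open ≡-Reasoning

-- Homogeneous linear systems over the integers.

NonzeroSolution : ∀ {m n} → (Fin m → Fin n → ℤ) → Set
NonzeroSolution {n = n} a = Σ[ x ∈ (Fin n → ℤ) ]
  (∃[ i ] x i ≢ 0ℤ) × (∀ j → sum (λ i → a j i * x i) ≡ 0ℤ)

-- Fraction-free Gaussian elimination of the first unknown.
underdetermined : ∀ {m n} → m ℕ.< n → (a : Fin m → Fin n → ℤ) →
  NonzeroSolution a
underdetermined {m} {suc n} m<1+n a with any? (λ j → ¬? (a j zero ℤ.≟ 0ℤ))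
-- The first column vanishes, so the first unit vector is a solution.
... | no ¬pivot = x , (zero , λ ()) , λ j → begin
  a j zero * 1ℤ + sum (λ i → a j (suc i) * 0ℤ)
    ≡⟨ cong₂ _+_ (cong (_* 1ℤ) (a≡0 j)) (sum-zero _ λ i → ℤ.*-zeroʳ (a j (suc i))) ⟩
  0ℤ ∎
  where
  open ≡-Reasoning
  x : Fin (suc n) → ℤ
  x zero    = 1ℤ
  x (suc _) = 0ℤ
  a≡0 : ∀ j → a j zero ≡ 0ℤ
  a≡0 j = decidable-stable (a j zero ℤ.≟ 0ℤ) (λ a≢0 → ¬pivot (j , a≢0))
underdetermined {suc m} {suc n} (ℕ.s≤s m<n) a | yes (j₀ , p≢0) = solution (underdetermined m<n reduced)
  where
  open ≡-Reasoning
  p : ℤ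
  p = a j₀ zero
  -- Each row other than the pivot row `j₀`, scaled by the pivot `p`, minus the multiple of the
  -- pivot row that clears its first entry.
  reduced : Fin m → Fin n → ℤ
  reduced j i = p * a (punchIn j₀ j) (suc i) - a (punchIn j₀ j) zero * a j₀ (suc i)
  solution : NonzeroSolution reduced → NonzeroSolution a
  solution (x , (i₀ , x≢0) , eqs) = y , (suc i₀ , py≢0) , λ j → begin
    a j zero * y zero + sum (λ i → a j (suc i) * (p * x i))
      ≡⟨ cong (λ z → a j zero * - tail j₀ + z) 
             (trans (sum-cong-≗ λ i → x∙yz≈y∙xz (a j (suc i)) p (x i))
                    (sym (*-distribˡ-sum p (λ i → a j (suc i) * x i)))) ⟩
    a j zero * - tail j₀ + p * tail j
      ≡⟨ cong (λ z → a j zero * - tail j₀ + z) (balanced j) ⟩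
    a j zero * - tail j₀ + a j zero * tail j₀
      ≡⟨ cancels (a j zero) (tail j₀) ⟩
    0ℤ ∎
    where
    tail : Fin (suc m) → ℤ
    tail j = sum (λ i → a j (suc i) * x i)
    -- Scaling the other unknowns by `p` makes the pivot equation solvable for the first one without
    -- division.
    y : Fin (suc n) → ℤ
    y zero    = - tail j₀
    y (suc i) = p * x i
    py≢0 : p * x i₀ ≢ 0ℤ
    py≢0 px≡0 with ℤ.i*j≡0⇒i≡0∨j≡0 p px≡0
    ... | inj₁ p≡0 = p≢0 p≡0
    ... | inj₂ x≡0 = x≢0 x≡0
    cancels : ∀ u v → u * - v + u * v ≡ 0ℤ
    cancels = solve-∀
    expand : ∀ p u q v x → p * (u * x) - q * (v * x) ≡ (p * u - q * v) * x
    expand = solve-∀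
    balanced : ∀ j → p * tail j ≡ a j zero * tail j₀
    balanced j with j₀ Fin.≟ j
    ... | yes refl = refl
    ... | no j₀≢j = subst (λ j → p * tail j ≡ a j zero * tail j₀) (punchIn-punchOut j₀≢j)
      (ℤ.i-j≡0⇒i≡j _ _ (begin
        p * tail j′ - a j′ zero * tail j₀
          ≡⟨ sum-linear p (a j′ zero) (λ i → a j′ (suc i) * x i) (λ i → a j₀ (suc i) * x i) ⟨
        sum (λ i → p * (a j′ (suc i) * x i) - a j′ zero * (a j₀ (suc i) * x i))
          ≡⟨ sum-cong-≗ (λ i → expand p _ (a j′ zero) _ (x i)) ⟩
        sum (λ i → reduced (punchOut j₀≢j) i * x i)
          ≡⟨ eqs (punchOut j₀≢j) ⟩
        0ℤ ∎))
      where j′ = punchIn j₀ (punchOut j₀≢j)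

-- Indicators of decidable propositions.

⟦_⟧ : ∀ {p} {P : Set p} → Dec P → ℤ
⟦ P? ⟧ = if does P? then 1ℤ else 0ℤ

module _ {p} {P : Set p} where

  ⟦⟧-true : (P? : Dec P) → P → ⟦ P? ⟧ ≡ 1ℤ
  ⟦⟧-true P? p rewrite dec-true P? p = refl

  ⟦⟧-false : (P? : Dec P) → ¬ P → ⟦ P? ⟧ ≡ 0ℤ
  ⟦⟧-false P? ¬p rewrite dec-false P? ¬p = refl

module _ {p q} {P : Set p} {Q : Set q} where

  ⟦⟧-⇔ : (P? : Dec P) (Q? : Dec Q) → (P → Q) → (Q → P) → ⟦ P? ⟧ ≡ ⟦ Q? ⟧
  ⟦⟧-⇔ (yes p) Q? to from = sym (⟦⟧-true Q? (to p))
  ⟦⟧-⇔ (no ¬p) Q? to from = sym (⟦⟧-false Q? (¬p ∘ from))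

  ⟦⟧-× : (P? : Dec P) (Q? : Dec Q) → ⟦ P? ⟧ * ⟦ Q? ⟧ ≡ ⟦ P? ×-dec Q? ⟧
  ⟦⟧-× (yes _) (yes _) = refl
  ⟦⟧-× (yes _) (no  _) = refl
  ⟦⟧-× (no  _) (yes _) = refl
  ⟦⟧-× (no  _) (no  _) = refl

sum-∈ : ∀ {n} (p : Subset n) → sum (λ x → ⟦ x ∈? p ⟧) ≡ + ∣ p ∣
sum-∈ []            = refl
sum-∈ (inside  ∷ p) = cong (λ z → 1ℤ + z) (sum-∈ p)
sum-∈ (outside ∷ p) = trans (ℤ.+-identityˡ _) (sum-∈ p)

sum-lookup-filter : ∀ {A : Set} {P : A → Set} (P? : ∀ x → Dec (P x)) xs →
  sum (λ i → ⟦ P? (lookup xs i) ⟧) ≡ + length (filter P? xs)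
sum-lookup-filter P? []       = refl
sum-lookup-filter P? (x ∷ xs) with does (P? x)
... | true  = cong (λ z → 1ℤ + z) (sum-lookup-filter P? xs)
... | false = trans (ℤ.+-identityˡ _) (sum-lookup-filter P? xs)

-- The decision procedures are abstract: with-abstraction fails on their unfolded forms.
abstract
  injective? : ∀ {n l} (p : Subset n) (π : Fin n → Fin l) → Dec (InjectiveOn p π)
  injective? = injectiveOn?

  sum-injective : ∀ {n l} (F : Family n l) p →
    sum (λ j → ⟦ injective? p (lookup F j) ⟧) ≡ + #injectiveOn F p
  sum-injective F p = sum-lookup-filter (injectiveOn? p) F

-- Disjointness and sizes of subsets.

Disjoint : ∀ {n} → Subset n → Subset n → Set
Disjoint p q = ∀ x → x ∈ p → x ∉ q

abstract
  disjoint? : ∀ {n} (p q : Subset n) → Dec (Disjoint p q)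
  disjoint? p q = all? λ x → (x ∈? p) →-dec ¬? (x ∈? q)

∣p∪q∣≡∣p∣+∣q∣ : ∀ {n} {p q : Subset n} → Disjoint p q → ∣ p ∪ q ∣ ≡ ∣ p ∣ ℕ.+ ∣ q ∣
∣p∪q∣≡∣p∣+∣q∣ {p = []}          {[]}          dis = refl
∣p∪q∣≡∣p∣+∣q∣ {p = inside ∷ p}  {inside ∷ q}  dis = contradiction here (dis zero here)
∣p∪q∣≡∣p∣+∣q∣ {p = inside ∷ p}  {outside ∷ q} dis =
  cong suc (∣p∪q∣≡∣p∣+∣q∣ λ x x∈p x∈q → dis (suc x) (there x∈p) (there x∈q))
∣p∪q∣≡∣p∣+∣q∣ {p = outside ∷ p} {inside ∷ q}  dis =
  trans (cong suc (∣p∪q∣≡∣p∣+∣q∣ λ x x∈p x∈q → dis (suc x) (there x∈p) (there x∈q)))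
        (sym (ℕ.+-suc ∣ p ∣ ∣ q ∣))
∣p∪q∣≡∣p∣+∣q∣ {p = outside ∷ p} {outside ∷ q} dis =
  ∣p∪q∣≡∣p∣+∣q∣ λ x x∈p x∈q → dis (suc x) (there x∈p) (there x∈q)

∣p∪⁅x⁆∣≡1+∣p∣ : ∀ {n} {p : Subset n} {x} → x ∉ p → ∣ p ∪ ⁅ x ⁆ ∣ ≡ suc ∣ p ∣
∣p∪⁅x⁆∣≡1+∣p∣ {p = p} {x} x∉p = begin
  ∣ p ∪ ⁅ x ⁆ ∣       ≡⟨ ∣p∪q∣≡∣p∣+∣q∣ (λ y y∈p y∈x → x∉p (subst (_∈ p) (x∈⁅y⁆⇒x≡y x y∈x) y∈p)) ⟩
  ∣ p ∣ ℕ.+ ∣ ⁅ x ⁆ ∣ ≡⟨ cong (∣ p ∣ ℕ.+_) (∣⁅x⁆∣≡1 x) ⟩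
  ∣ p ∣ ℕ.+ 1         ≡⟨ ℕ.+-comm ∣ p ∣ 1 ⟩
  suc ∣ p ∣           ∎
  where open ≡-Reasoning

-- An inequality that also covers `x ∈ p`, since inclusion-exclusion may add an element that is
-- already in the avoided set.
∣p∪⁅x⁆∣≤1+∣p∣ : ∀ {n} (p : Subset n) x → ∣ p ∪ ⁅ x ⁆ ∣ ℕ.≤ suc ∣ p ∣
∣p∪⁅x⁆∣≤1+∣p∣ p x with x ∈? p
... | no x∉p  = ℕ.≤-reflexive (∣p∪⁅x⁆∣≡1+∣p∣ x∉p)
... | yes x∈p = ℕ.m≤n⇒m≤1+n (p⊆q⇒∣p∣≤∣q∣ absorb)
  where
  absorb : p ∪ ⁅ x ⁆ ⊆ p
  absorb y∈ with x∈p∪q⁻ p ⁅ x ⁆ y∈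
  ... | inj₁ y∈p = y∈p
  ... | inj₂ y∈x = subst (_∈ p) (sym (x∈⁅y⁆⇒x≡y x y∈x)) x∈p

⊆∧∣∣≡⇒≡ : ∀ {n} {p q : Subset n} → p ⊆ q → ∣ p ∣ ≡ ∣ q ∣ → p ≡ q
⊆∧∣∣≡⇒≡ {p = p} {q} p⊆q ∣p∣≡∣q∣ = ⊆-antisym p⊆q λ {x} x∈q →
  decidable-stable (x ∈? p) λ x∉p →
    ℕ.<-irrefl ∣p∣≡∣q∣ (p⊂q⇒∣p∣<∣q∣ (p⊆q , x , x∈q , x∉p))

-- Listing the elements of a subset and the subsets of a given size.

elements : ∀ {n} → Subset n → List (Fin n)
elements []            = []
elements (inside  ∷ p) = zero ∷ map suc (elements p)
elements (outside ∷ p) = map suc (elements p)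

length-elements : ∀ {n} (p : Subset n) → length (elements p) ≡ ∣ p ∣
length-elements []            = refl
length-elements (inside  ∷ p) = cong suc (trans (length-map suc (elements p)) (length-elements p))
length-elements (outside ∷ p) = trans (length-map suc (elements p)) (length-elements p)

∈-elements : ∀ {n} {p : Subset n} {x} → x ∈ p → x ∈ˡ elements p
∈-elements {p = inside  ∷ p} here        = here refl
∈-elements {p = inside  ∷ p} (there x∈p) = there (∈-map⁺ suc (∈-elements x∈p))
∈-elements {p = outside ∷ p} (there x∈p) = ∈-map⁺ suc (∈-elements x∈p)

all-elements : ∀ {n} (p : Subset n) → All (_∈ p) (elements p)
all-elements []            = []
all-elements (inside  ∷ p) = here ∷ All.map⁺ (All.map there (all-elements p))
all-elements (outside ∷ p) = All.map⁺ (All.map there (all-elements p))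

-- The recursion is Pascal's, so the length is `n C d` by Pascal's identity. Positions in this list
-- index the unknowns and, with `l` for `n`, the target sets of the linear system.
subsets : ∀ n → ℕ → List (Subset n)
subsets zero    zero    = [] ∷ []
subsets zero    (suc d) = []
subsets (suc n) zero    = map (outside ∷_) (subsets n zero)
subsets (suc n) (suc d) = map (inside ∷_) (subsets n d) ++ map (outside ∷_) (subsets n (suc d))

length-subsets : ∀ n d → length (subsets n d) ≡ n C d
length-subsets zero    zero    = refl
length-subsets zero    (suc d) = refl
length-subsets (suc n) zero    = trans (length-map _ (subsets n zero)) (length-subsets n zero)
length-subsets (suc n) (suc d) = begin
  length (map (inside ∷_) (subsets n d) ++ map (outside ∷_) (subsets n (suc d)))
    ≡⟨ length-++ (map (inside ∷_) (subsets n d)) ⟩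
  length (map (inside ∷_) (subsets n d)) ℕ.+ length (map (outside ∷_) (subsets n (suc d)))
    ≡⟨ cong₂ ℕ._+_ (trans (length-map _ (subsets n d)) (length-subsets n d))
                   (trans (length-map _ (subsets n (suc d))) (length-subsets n (suc d))) ⟩
  n C d ℕ.+ n C suc d
    ≡⟨ nCk+nC[k+1]≡[n+1]C[k+1] n d ⟩
  suc n C suc d ∎
  where open ≡-Reasoning

all-subsets : ∀ n d → All (λ p → ∣ p ∣ ≡ d) (subsets n d)
all-subsets zero    zero    = refl ∷ []
all-subsets zero    (suc d) = []
all-subsets (suc n) zero    = All.map⁺ (all-subsets n zero)
all-subsets (suc n) (suc d) =
  All.++⁺ (All.map⁺ (All.map (cong suc) (all-subsets n d))) (All.map⁺ (all-subsets n (suc d)))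

∈-subsets : ∀ {n} (p : Subset n) → p ∈ˡ subsets n ∣ p ∣
∈-subsets []            = here refl
∈-subsets (inside  ∷ p) = ∈-++⁺ˡ (∈-map⁺ (inside ∷_) (∈-subsets p))
∈-subsets {suc n} (outside ∷ p) with ∣ p ∣ | ∈-subsets p
... | zero  | p∈ = ∈-map⁺ (outside ∷_) p∈
... | suc d | p∈ = ∈-++⁺ʳ (map (inside ∷_) (subsets n d)) (∈-map⁺ (outside ∷_) p∈)

unique-subsets : ∀ n d → Unique (subsets n d)
unique-subsets zero    zero    = [] ∷ []
unique-subsets zero    (suc d) = []
unique-subsets (suc n) zero    = Unique.map⁺ ∷-injectiveʳ (unique-subsets n zero)
unique-subsets (suc n) (suc d) = Unique.++⁺
  (Unique.map⁺ ∷-injectiveʳ (unique-subsets n d))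
  (Unique.map⁺ ∷-injectiveʳ (unique-subsets n (suc d)))
  λ (p∈ , p∈′) → inside≢outside (∈-map⁻ (inside ∷_) p∈) (∈-map⁻ (outside ∷_) p∈′)
  where
  inside≢outside : ∀ {p : Subset (suc n)} {xs ys : List (Subset n)} →
    ∃[ q ] (q ∈ˡ xs × p ≡ inside ∷ q) → ¬ (∃[ q ] (q ∈ˡ ys × p ≡ outside ∷ q))
  inside≢outside (_ , _ , refl) (_ , _ , ())

-- Lets sets be identified with their positions: distinct unknowns belong to distinct `d`-subsets of
-- [n], and an image has only one position among the `d`-subsets of [l].
lookup-injective : ∀ {A : Set} {xs : List A} → Unique xs → ∀ i j → lookup xs i ≡ lookup xs j → i ≡ j
lookup-injective (x∉ ∷ _) zero    zero    _  = refl
lookup-injective (x∉ ∷ _) zero    (suc j) eq = contradiction eq (All.lookup x∉ (∈-lookup j))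
lookup-injective (x∉ ∷ _) (suc i) zero    eq = contradiction (sym eq) (All.lookup x∉ (∈-lookup i))
lookup-injective (_ ∷ u)  (suc i) (suc j) eq = cong suc (lookup-injective u i j eq)

-- Images of subsets and injectivity.

image : ∀ {n l} → (Fin n → Fin l) → Subset n → Subset l
image π []            = ⊥
image π (inside  ∷ p) = ⁅ π zero ⁆ ∪ image (π ∘ suc) p
image π (outside ∷ p) = image (π ∘ suc) p

∈-image⁺ : ∀ {n l} (π : Fin n → Fin l) {p x} → x ∈ p → π x ∈ image π p
∈-image⁺ π {inside  ∷ p} here        = x∈p∪q⁺ (inj₁ (x∈⁅x⁆ (π zero)))
∈-image⁺ π {inside  ∷ p} (there x∈p) = x∈p∪q⁺ (inj₂ (∈-image⁺ (π ∘ suc) x∈p))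
∈-image⁺ π {outside ∷ p} (there x∈p) = ∈-image⁺ (π ∘ suc) x∈p

∈-image⁻ : ∀ {n l} (π : Fin n → Fin l) p {y} → y ∈ image π p → ∃[ x ] (x ∈ p × π x ≡ y)
∈-image⁻ π []            y∈ = contradiction y∈ ∉⊥
∈-image⁻ π (inside  ∷ p) y∈ with x∈p∪q⁻ ⁅ π zero ⁆ (image (π ∘ suc) p) y∈
... | inj₁ y∈0 = zero , here , sym (x∈⁅y⁆⇒x≡y (π zero) y∈0)
... | inj₂ y∈p = let x , x∈p , eq = ∈-image⁻ (π ∘ suc) p y∈p in suc x , there x∈p , eq
∈-image⁻ π (outside ∷ p) y∈ = let x , x∈p , eq = ∈-image⁻ (π ∘ suc) p y∈ in suc x , there x∈p , eq

InjectiveOn-∷ : ∀ {n l s} {p : Subset n} {π : Fin (suc n) → Fin l} →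
  InjectiveOn (s ∷ p) π → InjectiveOn p (π ∘ suc)
InjectiveOn-∷ inj x y x∈ y∈ eq = Fin.suc-injective (inj (suc x) (suc y) (there x∈) (there y∈) eq)

∣image∣ : ∀ {n l} {p : Subset n} (π : Fin n → Fin l) → InjectiveOn p π → ∣ image π p ∣ ≡ ∣ p ∣
∣image∣ {l = l} {[]} π inj = ∣⊥∣≡0 l
∣image∣ {p = outside ∷ p} π inj = ∣image∣ (π ∘ suc) (InjectiveOn-∷ inj)
∣image∣ {p = inside ∷ p} π inj = begin
  ∣ ⁅ π zero ⁆ ∪ image (π ∘ suc) p ∣         ≡⟨ ∣p∪q∣≡∣p∣+∣q∣ new ⟩
  ∣ ⁅ π zero ⁆ ∣ ℕ.+ ∣ image (π ∘ suc) p ∣   ≡⟨ cong₂ ℕ._+_ (∣⁅x⁆∣≡1 (π zero))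
                                                  (∣image∣ (π ∘ suc) (InjectiveOn-∷ inj)) ⟩
  suc ∣ p ∣                                  ∎
  where
  open ≡-Reasoning
  new : Disjoint ⁅ π zero ⁆ (image (π ∘ suc) p)
  new y y∈0 y∈p with ∈-image⁻ (π ∘ suc) p y∈p
  ... | x , x∈p , eq with inj (suc x) zero (there x∈p) here (trans eq (x∈⁅y⁆⇒x≡y (π zero) y∈0))
  ... | ()

-- With `injectiveOn-⊆` and `image-disjoint`, this splits injectivity on a disjoint union into a
-- condition on `p`, one on `q` and disjointness of the images. The last sees `p` only through its
-- image, which is what lets equations indexed by subsets of [l] control it.
injectiveOn-∪ : ∀ {n l} {p q : Subset n} (π : Fin n → Fin l) →
  InjectiveOn p π → InjectiveOn q π → Disjoint (image π p) (image π q) → InjectiveOn (p ∪ q) π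
injectiveOn-∪ {p = p} {q} π injp injq dis x y x∈ y∈ eq with x∈p∪q⁻ p q x∈ | x∈p∪q⁻ p q y∈
... | inj₁ x∈p | inj₁ y∈p = injp x y x∈p y∈p eq
... | inj₂ x∈q | inj₂ y∈q = injq x y x∈q y∈q eq
... | inj₁ x∈p | inj₂ y∈q =
  contradiction (∈-image⁺ π y∈q) (dis (π y) (subst (_∈ image π p) eq (∈-image⁺ π x∈p)))
... | inj₂ x∈q | inj₁ y∈p =
  contradiction (∈-image⁺ π x∈q) (dis (π x) (subst (_∈ image π p) (sym eq) (∈-image⁺ π y∈p)))

injectiveOn-⊆ : ∀ {n l} {p q : Subset n} {π : Fin n → Fin l} →
  p ⊆ q → InjectiveOn q π → InjectiveOn p π
injectiveOn-⊆ p⊆q inj x y x∈ y∈ = inj x y (p⊆q x∈) (p⊆q y∈)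

image-disjoint : ∀ {n l} {p q : Subset n} (π : Fin n → Fin l) →
  Disjoint p q → InjectiveOn (p ∪ q) π → Disjoint (image π p) (image π q)
image-disjoint {p = p} {q} π dis inj z z∈p z∈q
  with x , x∈p , refl ← ∈-image⁻ π p z∈p | y , y∈q , eq ← ∈-image⁻ π q z∈q
  with refl ← inj x y (x∈p∪q⁺ (inj₁ x∈p)) (x∈p∪q⁺ (inj₂ y∈q)) (sym eq) = dis x x∈p y∈q

disjoint-image⁻ : ∀ {n l} {p q : Subset n} (π : Fin n → Fin l) →
  Disjoint (image π p) (image π q) → Disjoint p q
disjoint-image⁻ π dis x x∈p x∈q = dis (π x) (∈-image⁺ π x∈p) (∈-image⁺ π x∈q)

-- Weights on `d`-subsets, tested against avoided sets.

module Avoidance {n N d : ℕ} (A : Fin N → Subset n) (∣A∣≡d : ∀ i → ∣ A i ∣ ≡ d) (x : Fin N → ℤ) where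

  -- The disjointness matrix between the sets `q` and the sets `A i`, applied to the vector `x`.
  avoiding : Subset n → ℤ
  avoiding q = sum λ i → x i * ⟦ disjoint? (A i) q ⟧

  -- Σ_{b ∉ q} avoiding (q ∪ {b}) counts each A i disjoint from q with the
  -- constant multiplicity n ∸ (d + ∣ q ∣).
  extensions : ∀ i q → sum (λ b → ⟦ b ∈? ∁ q ⟧ * ⟦ disjoint? (A i) (q ∪ ⁅ b ⁆) ⟧) ≡
                       ⟦ disjoint? (A i) q ⟧ * + (n ∸ (d ℕ.+ ∣ q ∣))
  extensions i q with disjoint? (A i) q
  ... | no ¬dis = sum-zero (λ b → ⟦ b ∈? ∁ q ⟧ * ⟦ disjoint? (A i) (q ∪ ⁅ b ⁆) ⟧) λ b → trans
      (cong (λ z → ⟦ b ∈? ∁ q ⟧ * z) (⟦⟧-false (disjoint? (A i) (q ∪ ⁅ b ⁆)) λ dis →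
        ¬dis λ y y∈A y∈q → dis y y∈A (x∈p∪q⁺ (inj₁ y∈q))))
      (ℤ.*-zeroʳ ⟦ b ∈? ∁ q ⟧)
  ... | yes dis = begin
    sum (λ b → ⟦ b ∈? ∁ q ⟧ * ⟦ disjoint? (A i) (q ∪ ⁅ b ⁆) ⟧)
      ≡⟨ sum-cong-≗ (λ b → trans (⟦⟧-× (b ∈? ∁ q) (disjoint? (A i) (q ∪ ⁅ b ⁆)))
                                 (⟦⟧-⇔ ((b ∈? ∁ q) ×-dec disjoint? (A i) (q ∪ ⁅ b ⁆))
                                       (b ∈? ∁ (A i ∪ q)) (to b) (from b))) ⟩
    sum (λ b → ⟦ b ∈? ∁ (A i ∪ q) ⟧)
      ≡⟨ sum-∈ (∁ (A i ∪ q)) ⟩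
    + ∣ ∁ (A i ∪ q) ∣
      ≡⟨ cong +_ (∣∁p∣≡n∸∣p∣ (A i ∪ q)) ⟩
    + (n ∸ ∣ A i ∪ q ∣)
      ≡⟨ cong (λ s → + (n ∸ s)) (trans (∣p∪q∣≡∣p∣+∣q∣ dis) (cong (ℕ._+ ∣ q ∣) (∣A∣≡d i))) ⟩
    + (n ∸ (d ℕ.+ ∣ q ∣))
      ≡⟨ ℤ.*-identityˡ (+ (n ∸ (d ℕ.+ ∣ q ∣))) ⟨
    1ℤ * + (n ∸ (d ℕ.+ ∣ q ∣)) ∎
    where
    open ≡-Reasoning
    to : ∀ b → b ∈ ∁ q × Disjoint (A i) (q ∪ ⁅ b ⁆) → b ∈ ∁ (A i ∪ q)
    to b (b∈∁q , dis′) = x∉p⇒x∈∁p λ b∈ → neither (x∈p∪q⁻ (A i) q b∈)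
      where
      neither : ¬ (b ∈ A i ⊎ b ∈ q)
      neither (inj₁ b∈A) = dis′ b b∈A (x∈p∪q⁺ (inj₂ (x∈⁅x⁆ b)))
      neither (inj₂ b∈q) = x∈∁p⇒x∉p b∈∁q b∈q
    from : ∀ b → b ∈ ∁ (A i ∪ q) → b ∈ ∁ q × Disjoint (A i) (q ∪ ⁅ b ⁆)
    from b b∈∁ = x∉p⇒x∈∁p (λ b∈q → x∈∁p⇒x∉p b∈∁ (x∈p∪q⁺ (inj₂ b∈q))) , dis′
      where
      dis′ : Disjoint (A i) (q ∪ ⁅ b ⁆)
      dis′ y y∈A y∈ with x∈p∪q⁻ q ⁅ b ⁆ y∈
      ... | inj₁ y∈q = dis y y∈A y∈q
      ... | inj₂ y∈b = x∈∁p⇒x∉p b∈∁ (x∈p∪q⁺ (inj₁ (subst (_∈ A i) (x∈⁅y⁆⇒x≡y b y∈b) y∈A)))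

  -- By `extensions`, summing `avoiding (q ∪ ⁅ b ⁆)` over all `b` outside `q` gives `avoiding q`
  -- times `n ∸ (d + e)`. Every summand is zero, and the factor is positive because `d + e < n`.
  avoiding-pred : ∀ e → d ℕ.+ e ℕ.< n → (∀ q → ∣ q ∣ ≡ suc e → avoiding q ≡ 0ℤ) →
    ∀ q → ∣ q ∣ ≡ e → avoiding q ≡ 0ℤ
  avoiding-pred e d+e<n avoid q refl =
    [ id , (λ r≡0 → contradiction (sym (ℤ.+-injective r≡0)) (ℕ.<⇒≢ (ℕ.m<n⇒0<n∸m d+e<n))) ]′
      (ℤ.i*j≡0⇒i≡0∨j≡0 (avoiding q) {+ r} total)
    where
    open ≡-Reasoning
    r : ℕ
    r = n ∸ (d ℕ.+ e)
    vanish : ∀ b → ⟦ b ∈? ∁ q ⟧ * avoiding (q ∪ ⁅ b ⁆) ≡ 0ℤ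
    vanish b with b ∈? ∁ q
    ... | no _     = refl
    ... | yes b∈∁q = trans (ℤ.*-identityˡ _) (avoid _ (∣p∪⁅x⁆∣≡1+∣p∣ (x∈∁p⇒x∉p b∈∁q)))
    total : avoiding q * + r ≡ 0ℤ
    total = begin
      avoiding q * + r
        ≡⟨ *-distribʳ-sum (+ r) (λ i → x i * ⟦ disjoint? (A i) q ⟧) ⟩
      sum (λ i → x i * ⟦ disjoint? (A i) q ⟧ * + r)
        ≡⟨ sum-cong-≗ (λ i → trans (ℤ.*-assoc (x i) _ _)
             (cong (λ z → x i * z) (sym (extensions i q)))) ⟩
      sum (λ i → x i * sum (λ b → ⟦ b ∈? ∁ q ⟧ * ⟦ disjoint? (A i) (q ∪ ⁅ b ⁆) ⟧))
        ≡⟨ sum-exchange x (λ b → ⟦ b ∈? ∁ q ⟧) (λ b i → ⟦ disjoint? (A i) (q ∪ ⁅ b ⁆) ⟧) ⟩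
      sum (λ b → ⟦ b ∈? ∁ q ⟧ * avoiding (q ∪ ⁅ b ⁆))
        ≡⟨ sum-zero _ vanish ⟩
      0ℤ ∎

  avoiding-≤ : ∀ e → d ℕ.+ e ℕ.≤ n → (∀ q → ∣ q ∣ ≡ e → avoiding q ≡ 0ℤ) →
    ∀ q → ∣ q ∣ ℕ.≤ e → avoiding q ≡ 0ℤ
  avoiding-≤ zero    _     avoid q ∣q∣≤0 = avoid q (ℕ.n≤0⇒n≡0 ∣q∣≤0)
  avoiding-≤ (suc e) d+e<n avoid q ∣q∣≤1+e with ℕ.m≤n⇒m<n∨m≡n ∣q∣≤1+e
  ... | inj₂ ∣q∣≡1+e       = avoid q ∣q∣≡1+e
  -- One level down, `d + suc e ≤ n` becomes the strict inequality that averaging needs.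
  ... | inj₁ (ℕ.s≤s ∣q∣≤e) = avoiding-≤ e (ℕ.<⇒≤ d+e<n′) (avoiding-pred e d+e<n′ avoid) q ∣q∣≤e
    where
    d+e<n′ : d ℕ.+ e ℕ.< n
    d+e<n′ = subst (ℕ._≤ n) (ℕ.+-suc d e) d+e<n

  -- Inclusion-exclusion, one required element at a time: the sets containing `a` and avoiding `q`
  -- are those avoiding `q` minus those avoiding `q ∪ ⁅ a ⁆`. An element moves from the required
  -- list to the avoided set, so the total stays at most `e`.
  containing-avoiding : ∀ {e} → (∀ q → ∣ q ∣ ℕ.≤ e → avoiding q ≡ 0ℤ) →
    ∀ ps q → length ps ℕ.+ ∣ q ∣ ℕ.≤ e →
    sum (λ i → x i * (⟦ All.all? (_∈? A i) ps ⟧ * ⟦ disjoint? (A i) q ⟧)) ≡ 0ℤ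
  containing-avoiding avoid [] q ∣q∣≤e =
    trans (sum-cong-≗ λ i → cong (λ z → x i * z) (ℤ.*-identityˡ ⟦ disjoint? (A i) q ⟧)) (avoid q ∣q∣≤e)
  containing-avoiding {e} avoid (a ∷ ps) q size = begin
    sum (λ i → x i * (⟦ All.all? (_∈? A i) (a ∷ ps) ⟧ * ⟦ disjoint? (A i) q ⟧))
      ≡⟨ sum-cong-≗ (λ i → trans (cong (λ z → x i * z) (split i)) (distrib (x i) _ _)) ⟩
    sum (λ i → 1ℤ * term q i - 1ℤ * term (q ∪ ⁅ a ⁆) i)
      ≡⟨ sum-linear 1ℤ 1ℤ (term q) (term (q ∪ ⁅ a ⁆)) ⟩
    1ℤ * sum (term q) - 1ℤ * sum (term (q ∪ ⁅ a ⁆))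
      ≡⟨ cong₂ (λ u v → 1ℤ * u - 1ℤ * v)
           (containing-avoiding avoid ps q (ℕ.≤-trans (ℕ.n≤1+n _) size))
           (containing-avoiding avoid ps (q ∪ ⁅ a ⁆) size′) ⟩
    0ℤ ∎
    where
    open ≡-Reasoning
    term : Subset n → Fin N → ℤ
    term q i = x i * (⟦ All.all? (_∈? A i) ps ⟧ * ⟦ disjoint? (A i) q ⟧)
    distrib : ∀ u v w → u * (v - w) ≡ 1ℤ * (u * v) - 1ℤ * (u * w)
    distrib = solve-∀
    size′ : length ps ℕ.+ ∣ q ∪ ⁅ a ⁆ ∣ ℕ.≤ e
    size′ = ℕ.≤-trans (ℕ.+-monoʳ-≤ (length ps) (∣p∪⁅x⁆∣≤1+∣p∣ q a))
                      (subst (ℕ._≤ e) (sym (ℕ.+-suc (length ps) ∣ q ∣)) size)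
    split : ∀ i → ⟦ All.all? (_∈? A i) (a ∷ ps) ⟧ * ⟦ disjoint? (A i) q ⟧ ≡
      ⟦ All.all? (_∈? A i) ps ⟧ * ⟦ disjoint? (A i) q ⟧
        - ⟦ All.all? (_∈? A i) ps ⟧ * ⟦ disjoint? (A i) (q ∪ ⁅ a ⁆) ⟧
    split i with a ∈? A i
    ... | yes a∈A = begin
      P * D
        ≡⟨ ℤ.+-identityʳ (P * D) ⟨
      P * D - 0ℤ
        ≡⟨ cong (λ z → P * D - z) (trans (cong (λ z → P * z) D′≡0) (ℤ.*-zeroʳ P)) ⟨
      P * D - P * ⟦ disjoint? (A i) (q ∪ ⁅ a ⁆) ⟧ ∎
      where
      P D : ℤ
      P = ⟦ All.all? (_∈? A i) ps ⟧
      D = ⟦ disjoint? (A i) q ⟧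
      D′≡0 : ⟦ disjoint? (A i) (q ∪ ⁅ a ⁆) ⟧ ≡ 0ℤ
      D′≡0 = ⟦⟧-false (disjoint? (A i) (q ∪ ⁅ a ⁆)) λ dis → dis a a∈A (x∈p∪q⁺ (inj₂ (x∈⁅x⁆ a)))
    ... | no a∉A = begin
      0ℤ
        ≡⟨ ℤ.+-inverseʳ (P * D) ⟨
      P * D - P * D
        ≡⟨ cong (λ z → P * D - P * z) (⟦⟧-⇔ (disjoint? (A i) q) (disjoint? (A i) (q ∪ ⁅ a ⁆)) to from) ⟩
      P * D - P * ⟦ disjoint? (A i) (q ∪ ⁅ a ⁆) ⟧ ∎
      where
      P D : ℤ
      P = ⟦ All.all? (_∈? A i) ps ⟧
      D = ⟦ disjoint? (A i) q ⟧
      to : Disjoint (A i) q → Disjoint (A i) (q ∪ ⁅ a ⁆)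
      to dis y y∈A y∈ with x∈p∪q⁻ q ⁅ a ⁆ y∈
      ... | inj₁ y∈q = dis y y∈A y∈q
      ... | inj₂ y∈a = a∉A (subst (_∈ A i) (x∈⁅y⁆⇒x≡y a y∈a) y∈A)
      from : Disjoint (A i) (q ∪ ⁅ a ⁆) → Disjoint (A i) q
      from dis y y∈A y∈q = dis y y∈A (x∈p∪q⁺ (inj₁ y∈q))

  -- Among the sets A j, only A i contains A i, so the weights of those containing A i sum to x i.
  avoiding-zero⇒zero : ∀ {e} → (∀ i j → A i ≡ A j → i ≡ j) → d ℕ.≤ e → d ℕ.+ e ℕ.≤ n →
    (∀ q → ∣ q ∣ ≡ e → avoiding q ≡ 0ℤ) → ∀ i → x i ≡ 0ℤ
  avoiding-zero⇒zero {e} A-injective d≤e d+e≤n avoid i = begin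
    x i
      ≡⟨ ℤ.*-identityʳ (x i) ⟨
    x i * (1ℤ * 1ℤ)
      ≡⟨ cong (λ z → x i * z) (cong₂ _*_
           (⟦⟧-true (All.all? (_∈? A i) (elements (A i))) (all-elements (A i)))
           (⟦⟧-true (disjoint? (A i) ⊥) λ _ _ → ∉⊥)) ⟨
    x i * (⟦ All.all? (_∈? A i) (elements (A i)) ⟧ * ⟦ disjoint? (A i) ⊥ ⟧)
      ≡⟨ sum-single _ i others ⟨
    sum (λ j → x j * (⟦ All.all? (_∈? A j) (elements (A i)) ⟧ * ⟦ disjoint? (A j) ⊥ ⟧))
      ≡⟨ containing-avoiding (avoiding-≤ e d+e≤n avoid) (elements (A i)) ⊥ size ⟩
    0ℤ ∎
    where
    open ≡-Reasoning
    size : length (elements (A i)) ℕ.+ ∣ ⊥ {n} ∣ ℕ.≤ e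
    size = subst (ℕ._≤ e)
      (sym (trans (cong₂ ℕ._+_ (trans (length-elements (A i)) (∣A∣≡d i)) (∣⊥∣≡0 n)) (ℕ.+-identityʳ d)))
      d≤e
    others : ∀ j → j ≢ i → x j * (⟦ All.all? (_∈? A j) (elements (A i)) ⟧ * ⟦ disjoint? (A j) ⊥ ⟧) ≡ 0ℤ
    others j j≢i = trans
      -- All the sets have size `d`, so one that contains `A i` equals it.
      (cong (λ z → x j * (z * ⟦ disjoint? (A j) ⊥ ⟧)) (⟦⟧-false (All.all? (_∈? A j) (elements (A i))) λ all →
        j≢i (sym (A-injective i j (⊆∧∣∣≡⇒≡ (λ y∈ → All.lookup all (∈-elements y∈))
                                            (trans (∣A∣≡d i) (sym (∣A∣≡d j))))))))
      (ℤ.*-zeroʳ (x j))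

-- The linear system of a balanced family, and the bound from its trivial kernel.

module Balance {n l : ℕ} (d e c : ℕ) (F : Family n l) (c≥1 : c ℕ.≥ 1)
  (balanced : ∀ S → ∣ S ∣ ≡ d ℕ.+ e → #injectiveOn F S ≡ c) where

  A : Fin (length (subsets n d)) → Subset n
  A = lookup (subsets n d)

  Y : Fin (length (subsets l d)) → Subset l
  Y = lookup (subsets l d)

  ∣A∣≡d : ∀ i → ∣ A i ∣ ≡ d
  ∣A∣≡d i = All.lookup (all-subsets n d) (∈-lookup i)

  π : Fin (length F) → Fin n → Fin l
  π = lookup F

  abstract
    -- The indicators of these propositions are the coefficients of the system: one equation for
    -- each pair of `j` and `y`, one unknown for each `i`.
    mapsOnto? : ∀ j y i → Dec (InjectiveOn (A i) (π j) × image (π j) (A i) ≡ Y y)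
    mapsOnto? j y i = injective? (A i) (π j) ×-dec ≡-dec Bool._≟_ (image (π j) (A i)) (Y y)

  -- For q of size e, weight j i q tells whether π j is injective on A i ∪ q,
  -- provided that it is injective on q and that A i and q are disjoint.
  weight : Fin (length F) → Fin (length (subsets n d)) → Subset n → ℤ
  weight j i q = ⟦ injective? (A i) (π j) ⟧ * ⟦ disjoint? (image (π j) (A i)) (image (π j) q) ⟧

  -- If `A i` meets `q`, their images meet and every weight vanishes. Otherwise each product is the
  -- indicator that `π j` is injective on `A i ∪ q`, a set of size `d + e`, and balance gives the
  -- count `c`.
  sum-weight : ∀ i q → ∣ q ∣ ≡ e →
    sum (λ j → ⟦ injective? q (π j) ⟧ * weight j i q) ≡ + c * ⟦ disjoint? (A i) q ⟧
  sum-weight i q ∣q∣≡e with disjoint? (A i) q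
  ... | no ¬dis = trans (sum-zero (λ j → ⟦ injective? q (π j) ⟧ * weight j i q) zero-weight)
                        (sym (ℤ.*-zeroʳ (+ c)))
    where
    zero-weight : ∀ j → ⟦ injective? q (π j) ⟧ * weight j i q ≡ 0ℤ
    zero-weight j = trans
      (cong (λ z → ⟦ injective? q (π j) ⟧ * (⟦ injective? (A i) (π j) ⟧ * z))
        (⟦⟧-false (disjoint? (image (π j) (A i)) (image (π j) q)) (λ dis → ¬dis (disjoint-image⁻ (π j) dis))))
      (trans (cong (λ z → ⟦ injective? q (π j) ⟧ * z) (ℤ.*-zeroʳ ⟦ injective? (A i) (π j) ⟧))
             (ℤ.*-zeroʳ ⟦ injective? q (π j) ⟧))
  ... | yes dis = begin
    sum (λ j → ⟦ injective? q (π j) ⟧ * weight j i q)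
      ≡⟨ sum-cong-≗ merge ⟩
    sum (λ j → ⟦ injective? (A i ∪ q) (π j) ⟧)
      ≡⟨ sum-injective F (A i ∪ q) ⟩
    + #injectiveOn F (A i ∪ q)
      ≡⟨ cong +_ (balanced (A i ∪ q) (trans (∣p∪q∣≡∣p∣+∣q∣ dis) (cong₂ ℕ._+_ (∣A∣≡d i) ∣q∣≡e))) ⟩
    + c
      ≡⟨ ℤ.*-identityʳ (+ c) ⟨
    + c * 1ℤ ∎
    where
    open ≡-Reasoning
    merge : ∀ j → ⟦ injective? q (π j) ⟧ * weight j i q ≡ ⟦ injective? (A i ∪ q) (π j) ⟧
    merge j = begin
      ⟦ injq? ⟧ * (⟦ injA? ⟧ * ⟦ dis? ⟧)   ≡⟨ cong (λ z → ⟦ injq? ⟧ * z) (⟦⟧-× injA? dis?) ⟩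
      ⟦ injq? ⟧ * ⟦ injA? ×-dec dis? ⟧     ≡⟨ ⟦⟧-× injq? (injA? ×-dec dis?) ⟩
      ⟦ injq? ×-dec (injA? ×-dec dis?) ⟧   ≡⟨ ⟦⟧-⇔
                                     (injq? ×-dec (injA? ×-dec dis?)) (injective? (A i ∪ q) (π j))
                                     (λ (injq , injA , dis′) → injectiveOn-∪ (π j) injA injq dis′)
                                     (λ inj → injectiveOn-⊆ (q⊆p∪q (A i) q) inj ,
                                              injectiveOn-⊆ (p⊆p∪q q) inj ,
                                              image-disjoint (π j) dis inj) ⟩
      ⟦ injective? (A i ∪ q) (π j) ⟧ ∎
      where
      injq? = injective? q (π j)
      injA? = injective? (A i) (π j)
      dis? = disjoint? (image (π j) (A i)) (image (π j) q)

  -- When `π j` is injective on `A i`, the image has size `d` and is `Y y` for exactly one `y`;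
  -- otherwise all terms vanish. For fixed `j` and `q`, this writes the weights as a combination of
  -- equations of the system, with coefficients independent of `i`.
  weight-by-image : ∀ j i q →
    weight j i q ≡ sum (λ y → ⟦ disjoint? (Y y) (image (π j) q) ⟧ * ⟦ mapsOnto? j y i ⟧)
  weight-by-image j i q = by-cases (injective? (A i) (π j))
    where
    open ≡-Reasoning
    E : Subset l → ℤ
    E p = ⟦ disjoint? p (image (π j) q) ⟧
    by-cases : Dec (InjectiveOn (A i) (π j)) →
      weight j i q ≡ sum (λ y → E (Y y) * ⟦ mapsOnto? j y i ⟧)
    by-cases (no ¬inj) = begin
      weight j i q
        ≡⟨ cong (_* E (image (π j) (A i))) (⟦⟧-false (injective? (A i) (π j)) ¬inj) ⟩
      0ℤ
        ≡⟨ sum-zero (λ y → E (Y y) * ⟦ mapsOnto? j y i ⟧) (λ y →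
             trans (cong (λ z → E (Y y) * z) (⟦⟧-false (mapsOnto? j y i) (¬inj ∘ proj₁)))
                   (ℤ.*-zeroʳ (E (Y y)))) ⟨
      sum (λ y → E (Y y) * ⟦ mapsOnto? j y i ⟧) ∎
    by-cases (yes inj) = begin
      weight j i q
        ≡⟨ cong (_* E (image (π j) (A i))) (⟦⟧-true (injective? (A i) (π j)) inj) ⟩
      1ℤ * E (image (π j) (A i))
        ≡⟨ ℤ.*-comm 1ℤ (E (image (π j) (A i))) ⟩
      E (image (π j) (A i)) * 1ℤ
        ≡⟨ cong₂ _*_ (cong E image≡Y) (sym (⟦⟧-true (mapsOnto? j y₀ i) (inj , image≡Y))) ⟩
      E (Y y₀) * ⟦ mapsOnto? j y₀ i ⟧
        ≡⟨ sum-single (λ y → E (Y y) * ⟦ mapsOnto? j y i ⟧) y₀ (λ y y≢y₀ →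
             trans (cong (λ z → E (Y y) * z) (⟦⟧-false (mapsOnto? j y i) λ (_ , image≡Yy) →
               y≢y₀ (lookup-injective (unique-subsets l d) y y₀ (trans (sym image≡Yy) image≡Y))))
             (ℤ.*-zeroʳ (E (Y y)))) ⟨
      sum (λ y → E (Y y) * ⟦ mapsOnto? j y i ⟧) ∎
      where
      image∈ : image (π j) (A i) ∈ˡ subsets l d
      image∈ = subst (λ s → image (π j) (A i) ∈ˡ subsets l s)
                     (trans (∣image∣ (π j) inj) (∣A∣≡d i)) (∈-subsets (image (π j) (A i)))
      y₀ : Fin (length (subsets l d))
      y₀ = Any.index image∈
      image≡Y : image (π j) (A i) ≡ Y y₀
      image≡Y = Any.lookup-index image∈

  module _ (x : Fin (length (subsets n d)) → ℤ)
    (x⊥ : ∀ j y → sum (λ i → x i * ⟦ mapsOnto? j y i ⟧) ≡ 0ℤ) where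
    open Avoidance A ∣A∣≡d x

    -- A vector orthogonal to all rows of the system is orthogonal to their combinations.
    sum-weight≡0 : ∀ j q → sum (λ i → x i * weight j i q) ≡ 0ℤ
    sum-weight≡0 j q = begin
      sum (λ i → x i * weight j i q)
        ≡⟨ sum-cong-≗ (λ i → cong (λ z → x i * z) (weight-by-image j i q)) ⟩
      sum (λ i → x i * sum (λ y → E y * ⟦ mapsOnto? j y i ⟧))
        ≡⟨ sum-exchange x E (λ y i → ⟦ mapsOnto? j y i ⟧) ⟩
      sum (λ y → E y * sum (λ i → x i * ⟦ mapsOnto? j y i ⟧))
        ≡⟨ sum-zero _ (λ y → trans (cong (λ z → E y * z) (x⊥ j y)) (ℤ.*-zeroʳ (E y))) ⟩
      0ℤ ∎
      where
      open ≡-Reasoning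
      E : Fin (length (subsets l d)) → ℤ
      E y = ⟦ disjoint? (Y y) (image (π j) q) ⟧

    -- The weights, multiplied by `x i` and `I j`, are summed in two orders. Over `j` first,
    -- `sum-weight` gives `c` times `avoiding q`; over `i` first, every inner sum is zero. Since `c`
    -- is positive, it cancels.
    avoiding≡0 : ∀ q → ∣ q ∣ ≡ e → avoiding q ≡ 0ℤ
    avoiding≡0 q ∣q∣≡e =
      [ (λ c≡0 → contradiction (sym (ℤ.+-injective c≡0)) (ℕ.<⇒≢ c≥1)) , id ]′
        (ℤ.i*j≡0⇒i≡0∨j≡0 (+ c) {avoiding q} total)
      where
      open ≡-Reasoning
      I : Fin (length F) → ℤ
      I j = ⟦ injective? q (π j) ⟧
      total : + c * avoiding q ≡ 0ℤ
      total = begin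
        + c * avoiding q
          ≡⟨ *-distribˡ-sum (+ c) (λ i → x i * ⟦ disjoint? (A i) q ⟧) ⟩
        sum (λ i → + c * (x i * ⟦ disjoint? (A i) q ⟧))
          ≡⟨ sum-cong-≗ (λ i → trans (x∙yz≈y∙xz (+ c) (x i) _)
                               (cong (λ z → x i * z) (sym (sum-weight i q ∣q∣≡e)))) ⟩
        sum (λ i → x i * sum (λ j → I j * weight j i q))
          ≡⟨ sum-exchange x I (λ j i → weight j i q) ⟩
        sum (λ j → I j * sum (λ i → x i * weight j i q))
          ≡⟨ sum-zero _ (λ j → trans (cong (λ z → I j * z) (sum-weight≡0 j q)) (ℤ.*-zeroʳ (I j))) ⟩
        0ℤ ∎

    orthogonal⇒zero : d ℕ.≤ e → d ℕ.+ e ℕ.≤ n → ∀ i → x i ≡ 0ℤ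
    orthogonal⇒zero d≤e d+e≤n =
      avoiding-zero⇒zero (lookup-injective (unique-subsets n d)) d≤e d+e≤n avoiding≡0

  -- With fewer equations than unknowns the system would have a nonzero solution, against
  -- `orthogonal⇒zero`.
  family-size : d ℕ.≤ e → d ℕ.+ e ℕ.≤ n → n C d ℕ.≤ length F ℕ.* (l C d)
  family-size d≤e d+e≤n = subst₂ (λ N M → N ℕ.≤ length F ℕ.* M)
    (length-subsets n d) (length-subsets l d) (ℕ.≮⇒≥ λ few → absurd (underdetermined few equations))
    where
    equations : Fin (length F ℕ.* length (subsets l d)) → Fin (length (subsets n d)) → ℤ
    equations r i = let j , y = remQuot (length (subsets l d)) r in ⟦ mapsOnto? j y i ⟧
    absurd : ¬ NonzeroSolution equations
    absurd (x , (i , x≢0) , eqs) = x≢0 (orthogonal⇒zero x x⊥ d≤e d+e≤n i)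
      where
      x⊥ : ∀ j y → sum (λ i → x i * ⟦ mapsOnto? j y i ⟧) ≡ 0ℤ
      x⊥ j y = trans
        (sum-cong-≗ λ i → trans (ℤ.*-comm (x i) ⟦ mapsOnto? j y i ⟧)
          (cong (λ (j , y) → ⟦ mapsOnto? j y i ⟧ * x i) (sym (remQuot-combine j y))))
        (eqs (combine j y))

-- Binomial coefficients and their partial sums.

binomialSum-suc : ∀ n m → binomialSum n (suc m) ≡ binomialSum n m ℕ.+ n C suc m
binomialSum-suc n m = begin
  List.sum (applyUpTo (n C_) (suc (suc m)))                    ≡⟨ cong List.sum (applyUpTo-∷ʳ (n C_) (suc m)) ⟨
  List.sum (applyUpTo (n C_) (suc m) ∷ʳ n C suc m)             ≡⟨ sum-++ (applyUpTo (n C_) (suc m)) _ ⟩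
  binomialSum n m ℕ.+ (n C suc m ℕ.+ 0)                        ≡⟨ cong (binomialSum n m ℕ.+_) (ℕ.+-identityʳ _) ⟩
  binomialSum n m ℕ.+ n C suc m                                ∎
  where open ≡-Reasoning

-- (k + 1) C(n, k + 1) = (n − k) C(n, k), with the subtracted term moved to the left.
absorption : ∀ n k → suc k ℕ.* (n C suc k) ℕ.+ k ℕ.* (n C k) ≡ n ℕ.* (n C k)
absorption zero    zero    = refl
absorption zero    (suc k) = cong₂ ℕ._+_ (ℕ.*-zeroʳ (suc (suc k))) (ℕ.*-zeroʳ (suc k))
absorption (suc n) zero    = trans (cong (λ z → 1 ℕ.* z ℕ.+ 0) (nC1≡n (suc n))) (one (suc n))
  where
  one : ∀ n → 1 ℕ.* n ℕ.+ 0 ≡ n ℕ.* 1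
  one = ℕ.solve-∀
absorption (suc n) (suc k) = begin
  suc (suc k) ℕ.* (suc n C suc (suc k)) ℕ.+ suc k ℕ.* (suc n C suc k)
    ≡⟨ cong₂ (λ u v → suc (suc k) ℕ.* u ℕ.+ suc k ℕ.* v)
         (sym (nCk+nC[k+1]≡[n+1]C[k+1] n (suc k))) (sym (nCk+nC[k+1]≡[n+1]C[k+1] n k)) ⟩
  suc (suc k) ℕ.* (b ℕ.+ c) ℕ.+ suc k ℕ.* (a ℕ.+ b)
    -- Isolates the left sides of the two induction hypotheses, at `suc k` and at `k`, leaving
    -- `a + b`.
    ≡⟨ regroup k a b c ⟩
  (suc (suc k) ℕ.* c ℕ.+ suc k ℕ.* b) ℕ.+ (suc k ℕ.* b ℕ.+ k ℕ.* a) ℕ.+ (a ℕ.+ b)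
    ≡⟨ cong₂ (λ u v → u ℕ.+ v ℕ.+ (a ℕ.+ b)) (absorption n (suc k)) (absorption n k) ⟩
  n ℕ.* b ℕ.+ n ℕ.* a ℕ.+ (a ℕ.+ b)
    ≡⟨ collect n a b ⟩
  suc n ℕ.* (a ℕ.+ b)
    ≡⟨ cong (suc n ℕ.*_) (nCk+nC[k+1]≡[n+1]C[k+1] n k) ⟩
  suc n ℕ.* (suc n C suc k) ∎
  where
  open ≡-Reasoning
  a b c : ℕ
  a = n C k
  b = n C suc k
  c = n C suc (suc k)
  regroup : ∀ k a b c → suc (suc k) ℕ.* (b ℕ.+ c) ℕ.+ suc k ℕ.* (a ℕ.+ b) ≡
    (suc (suc k) ℕ.* c ℕ.+ suc k ℕ.* b) ℕ.+ (suc k ℕ.* b ℕ.+ k ℕ.* a) ℕ.+ (a ℕ.+ b)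
  regroup = ℕ.solve-∀
  collect : ∀ n a b → n ℕ.* b ℕ.+ n ℕ.* a ℕ.+ (a ℕ.+ b) ≡ suc n ℕ.* (a ℕ.+ b)
  collect = ℕ.solve-∀

-- Truncated subtraction does no harm: for `k > n` both sides are zero.
[1+k]*nC[1+k]≡[n∸k]*nCk : ∀ n k → suc k ℕ.* (n C suc k) ≡ (n ∸ k) ℕ.* (n C k)
[1+k]*nC[1+k]≡[n∸k]*nCk n k = begin
  suc k ℕ.* (n C suc k)                                       ≡⟨ ℕ.m+n∸n≡m _ (k ℕ.* (n C k)) ⟨
  suc k ℕ.* (n C suc k) ℕ.+ k ℕ.* (n C k) ∸ k ℕ.* (n C k)     ≡⟨ cong (_∸ k ℕ.* (n C k)) (absorption n k) ⟩
  n ℕ.* (n C k) ∸ k ℕ.* (n C k)                               ≡⟨ ℕ.*-distribʳ-∸ (n C k) n k ⟨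
  (n ∸ k) ℕ.* (n C k)                                         ∎
  where open ≡-Reasoning

-- Induction on `d`, with the ratios cross-multiplied. The newly added terms contribute the same
-- product on both sides. For the older terms, multiplying by `suc d` turns the coefficients at
-- `suc d` into those at `d` with factors `l ∸ d` and `n ∸ d`, and `l ∸ d ≤ n ∸ d`.
binomialSum-ratio : ∀ {n l} → l ℕ.≤ n → ∀ d →
  (l C d) ℕ.* binomialSum n d ℕ.≤ (n C d) ℕ.* binomialSum l d
binomialSum-ratio l≤n zero = ℕ.≤-refl
binomialSum-ratio {n} {l} l≤n (suc d) = begin
  (l C suc d) ℕ.* binomialSum n (suc d)
    ≡⟨ cong ((l C suc d) ℕ.*_) (binomialSum-suc n d) ⟩
  (l C suc d) ℕ.* (binomialSum n d ℕ.+ n C suc d)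
    ≡⟨ ℕ.*-distribˡ-+ (l C suc d) _ _ ⟩
  (l C suc d) ℕ.* binomialSum n d ℕ.+ (l C suc d) ℕ.* (n C suc d)
    ≤⟨ ℕ.+-mono-≤ (ℕ.*-cancelˡ-≤ (suc d) scaled) (ℕ.≤-reflexive (ℕ.*-comm (l C suc d) _)) ⟩
  (n C suc d) ℕ.* binomialSum l d ℕ.+ (n C suc d) ℕ.* (l C suc d)
    ≡⟨ ℕ.*-distribˡ-+ (n C suc d) _ _ ⟨
  (n C suc d) ℕ.* (binomialSum l d ℕ.+ l C suc d)
    ≡⟨ cong ((n C suc d) ℕ.*_) (binomialSum-suc l d) ⟨
  (n C suc d) ℕ.* binomialSum l (suc d) ∎
  where
  open ℕ.≤-Reasoning
  absorb : ∀ m s → suc d ℕ.* ((m C suc d) ℕ.* s) ≡ (m ∸ d) ℕ.* ((m C d) ℕ.* s)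
  absorb m s = trans (sym (ℕ.*-assoc (suc d) (m C suc d) s))
    (trans (cong (ℕ._* s) ([1+k]*nC[1+k]≡[n∸k]*nCk m d)) (ℕ.*-assoc (m ∸ d) (m C d) s))
  scaled : suc d ℕ.* ((l C suc d) ℕ.* binomialSum n d) ℕ.≤ suc d ℕ.* ((n C suc d) ℕ.* binomialSum l d)
  scaled = begin
    suc d ℕ.* ((l C suc d) ℕ.* binomialSum n d)   ≡⟨ absorb l (binomialSum n d) ⟩
    (l ∸ d) ℕ.* ((l C d) ℕ.* binomialSum n d)     ≤⟨ ℕ.*-mono-≤ (ℕ.∸-monoˡ-≤ d l≤n) (binomialSum-ratio l≤n d) ⟩
    (n ∸ d) ℕ.* ((n C d) ℕ.* binomialSum l d)     ≡⟨ absorb n (binomialSum l d) ⟨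
    suc d ℕ.* ((n C suc d) ℕ.* binomialSum l d)   ∎

nCk≢0 : ∀ {n k} → k ℕ.≤ n → NonZero (n C k)
nCk≢0 {n} {zero} _ = _
nCk≢0 {suc n} {suc k} (ℕ.s≤s k≤n) = ℕ.>-nonZero (subst (0 ℕ.<_) (nCk+nC[k+1]≡[n+1]C[k+1] n k)
  (ℕ.<-≤-trans (ℕ.>-nonZero⁻¹ (n C k) {{nCk≢0 k≤n}}) (ℕ.m≤m+n (n C k) (n C suc k))))

-- Passage to rational numbers and the final bounds.

-- In unnormalised form the comparison is plain cross-multiplication. The numerator is an integer
-- because the even case subtracts in ℤ.
/-≤-integer : ∀ (a : ℕ) (b : ℤ) s .{{_ : NonZero s}} → b ℤ.≤ + (a ℕ.* s) → (+ a) / 1 ≥ b / s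
/-≤-integer a b s@(suc _) b≤as = ℚ.toℚᵘ-cancel-≤ (begin
  toℚᵘ (b / s)        ≃⟨ ℚ.toℚᵘ-fromℚᵘ (b ℚᵘ./ s) ⟩
  b ℚᵘ./ s            ≤⟨ ℚᵘ.*≤* (subst₂ ℤ._≤_ (sym (ℤ.*-identityʳ b)) (ℤ.pos-* a s) b≤as) ⟩
  (+ a) ℚᵘ./ 1        ≃⟨ ℚ.toℚᵘ-fromℚᵘ ((+ a) ℚᵘ./ 1) ⟨
  toℚᵘ ((+ a) / 1)    ∎)
  where open ℚᵘ.≤-Reasoning

-- Chains `binomialSum-ratio` with `family-size` and cancels `l C d`, which is nonzero because
-- `d ≤ k ≤ l`. Rounding down for `d` and up for `e` ensures `d ≤ e`.
family-size-binomialSum : ∀ {n l k} → n > l → l ≥ℕ k → (F : Family n l) → PerfectlyBalanced k F →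
  binomialSum n ⌊ k /2⌋ ℕ.≤ length F ℕ.* binomialSum l ⌊ k /2⌋
family-size-binomialSum {n} {l} {k} n>l l≥k F (c , c≥1 , balanced) =
  ℕ.*-cancelˡ-≤ (l C d) {{nCk≢0 (ℕ.≤-trans (ℕ.⌊n/2⌋≤n k) l≥k)}} (begin
    (l C d) ℕ.* binomialSum n d
      ≤⟨ binomialSum-ratio (ℕ.<⇒≤ n>l) d ⟩
    (n C d) ℕ.* binomialSum l d
      ≤⟨ ℕ.*-monoˡ-≤ (binomialSum l d) (Balance.family-size d e c F c≥1 balanced′ (ℕ.⌊n/2⌋≤⌈n/2⌉ k)
           (subst (ℕ._≤ n) (sym d+e≡k) (ℕ.≤-trans l≥k (ℕ.<⇒≤ n>l)))) ⟩
    length F ℕ.* (l C d) ℕ.* binomialSum l d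
      ≡⟨ reorder (length F) (l C d) (binomialSum l d) ⟩
    (l C d) ℕ.* (length F ℕ.* binomialSum l d) ∎)
  where
  open ℕ.≤-Reasoning
  d e : ℕ
  d = ⌊ k /2⌋
  e = ⌈ k /2⌉
  d+e≡k : d ℕ.+ e ≡ k
  d+e≡k = ℕ.⌊n/2⌋+⌈n/2⌉≡n k
  balanced′ : ∀ S → ∣ S ∣ ≡ d ℕ.+ e → #injectiveOn F S ≡ c
  balanced′ S ∣S∣≡d+e = balanced S (trans ∣S∣≡d+e d+e≡k)
  reorder : ∀ a b s → a ℕ.* b ℕ.* s ≡ b ℕ.* (a ℕ.* s)
  reorder = ℕ.solve-∀

theorem72 : (n l k : ℕ) → n > l → l ≥ℕ k → k > 0 →
    (F : Family n l) → PerfectlyBalanced k F →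
    (¬ (2 ∣ k) →
    (+ length F) / 1 ≥ (+ binomialSum n ⌊ k /2⌋) / binomialSum l ⌊ k /2⌋)
    × (2 ∣ k →
    (+ length F) / 1 ≥ ((+ binomialSum n ⌊ k /2⌋) - (+ ((n ∸ 1) C ⌊ k /2⌋))) / binomialSum l ⌊ k /2⌋)
theorem72 n l k n>l l≥k _ F balanced =
  (λ _ → /-≤-integer (length F) (+ sₙ) (binomialSum l ⌊ k /2⌋) bound) ,
  -- Subtracting the natural number `r` can only lower the numerator, so `bound` still applies.
  (λ _ → /-≤-integer (length F) (+ sₙ - + r) (binomialSum l ⌊ k /2⌋)
           (ℤ.≤-trans (ℤ.i-j≤i (+ sₙ) (+ r)) bound))
  where
  sₙ r : ℕ
  sₙ = binomialSum n ⌊ k /2⌋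
  r = (n ∸ 1) C ⌊ k /2⌋
  bound : + sₙ ℤ.≤ + (length F ℕ.* binomialSum l ⌊ k /2⌋)
  bound = ℤ.+≤+ (family-size-binomialSum n>l l≥k F balanced)
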